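{- There exists a constant $k$ such that for every $(4K_1, C_4, C_6)$-free graph $G$ that contains a $C_7$ as an induced subgraph, and for every induced $C_7$ of $G$, the graph $G - C_7$ obtained from $G$ by deleting the seven vertices of this $C_7$ admits a $k$-uniform partition.
   Context: Graphs are finite, simple and undirected. For a set $L$ of graphs, a graph is $L$-free if it contains no graph of $L$ as an induced subgraph. $C_\ell$ denotes the chordless cycle on $\ell$ vertices, and $4K_1$ denotes the graph with four vertices and no edges. Consider a partition $\mathcal{P}$ of the vertex set of a graph into sets $S_1, \ldots, S_k$ (sets are allowed to be empty) such that each $S_i$ induces a clique. A set $S_i$ is uniform to a set $S_j$ ($j \ne i$) if either there is no edge between any vertex of $S_i$ and any vertex of $S_j$, or every vertex of $S_i$ is adjacent to every vertex of $S_j$. The set $S_i$ is uniform in $\mathcal{P}$ if every set $S_j$ with $j\neq i$ is uniform to it. The partition $\mathcal{P}$ is uniform if every set $S_i$ is uniform in $\mathcal{P}$. A $k$-uniform partition is a uniform partition into $k$ sets, each of which induces a clique. -}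

module Defs where

open import Data.Empty using (⊥)
open import Data.Fin.Base using (Fin; toℕ)
open import Data.Fin.Properties using (toℕ<n)
open import Data.List.Base using (List)
open import Data.List.Relation.Unary.All using (All)
open import Data.Nat.Base using (ℕ; suc; _≤_; _<_; z≤n; s≤s; NonZero; >-nonZero)
open import Data.Nat.DivMod using (_%_; m<n⇒m%n≡m; n%n≡0)
open import Data.Nat.Properties using (_≟_; _≤?_; ≤-trans; m≤n⇒m<n∨m≡n; 1+n≢n)
open import Data.Product.Base using (∃-syntax; _,_; proj₂)
open import Data.Refinement using (Refinement-syntax; value)
open import Data.Sum.Base using (_⊎_; inj₁; inj₂; swap)
open import Function.Base using (_∘_; id)
open import Function.Bundles using (_⇔_)
open import Function.Definitions using (Injective)
open import Level using (0ℓ)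
open import Relation.Binary.Core using (Rel)
open import Relation.Binary.Definitions using (Decidable; Symmetric)
open import Relation.Binary.PropositionalEquality using (_≡_; _≢_; refl; sym; trans)
open import Relation.Nullary using (¬_; no)
open import Relation.Nullary.Decidable using (True; toWitness; _⊎-dec_)
open import Relation.Unary using (Pred; _∈_; _∉_)

-- Simple undirected graphs with vertex set V.  Adjacency is decidable, as it
-- is for any concretely given finite graph; this keeps the classical content
-- of the notions below.
record Graph (V : Set) : Set₁ where
  field
    Adj    : Rel V 0ℓ
    adj?   : Decidable Adj
    symm   : Symmetric Adj
    irrefl : ∀ {v} → ¬ Adj v v

open Graph public

FiniteGraph : Set₁
FiniteGraph = ∃[ n ] Graph (Fin n)

-- An induced copy of H in G; the chosen vertices of G are the values of `vertex`.
record _Induced⊆_ {U V : Set} (H : Graph U) (G : Graph V) : Set where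
  field
    vertex    : U → V
    injective : Injective _≡_ _≡_ vertex
    induced   : ∀ u v → Adj H u v ⇔ Adj G (vertex u) (vertex v)

open _Induced⊆_ public

vertices : {U V : Set} {H : Graph U} {G : Graph V} → H Induced⊆ G → Pred V 0ℓ
vertices c v = ∃[ u ] vertex c u ≡ v

_-free : List FiniteGraph → {V : Set} → Graph V → Set₁
(L -free) G = All (λ (_ , H) → ¬ (H Induced⊆ G)) L

-- Vertices of G - S carry the proof of v ∉ S irrelevantly, so that two of
-- them are equal as soon as their underlying vertices of G are.
_-_ : {V : Set} → Graph V → (S : Pred V 0ℓ) → Graph [ v ∈ V ∣ v ∉ S ]
(G - S) .Adj u v  = Adj G (value u) (value v)
(G - S) .adj? u v = adj? G (value u) (value v)
(G - S) .symm     = symm G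
(G - S) .irrefl   = irrefl G

edgeless : ∀ n → Graph (Fin n)
edgeless n .Adj _ _  = ⊥
edgeless n .adj? _ _ = no id
edgeless n .symm     = id
edgeless n .irrefl   = id

4K₁ : FiniteGraph
4K₁ = 4 , edgeless 4

private
  nonZero : ∀ {ℓ} → 3 ≤ ℓ → NonZero ℓ
  nonZero = >-nonZero ∘ ≤-trans (s≤s z≤n)

  suc%≢ : ∀ {ℓ m} (3≤ℓ : 3 ≤ ℓ) → m < ℓ → (suc m % ℓ) {{nonZero 3≤ℓ}} ≢ m
  suc%≢ {ℓ} {m} 3≤ℓ m<ℓ eq with m≤n⇒m<n∨m≡n m<ℓ
  ... | inj₁ sm<ℓ = 1+n≢n (trans (sym (m<n⇒m%n≡m {{nonZero 3≤ℓ}} sm<ℓ)) eq)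
  ... | inj₂ refl with trans (sym (n%n≡0 ℓ {{nonZero 3≤ℓ}})) eq
  ...   | refl with s≤s () ← 3≤ℓ

-- The chordless cycle, with vertices 0, …, ℓ-1 in cyclic order.
cycle : ∀ ℓ → 3 ≤ ℓ → Graph (Fin ℓ)
cycle ℓ 3≤ℓ = record
  { Adj    = λ i j → Next i j ⊎ Next j i
  ; adj?   = λ i j → (_ ≟ _) ⊎-dec (_ ≟ _)
  ; symm   = swap
  ; irrefl = λ { {i} (inj₁ e) → suc%≢ 3≤ℓ (toℕ<n i) e
               ; {i} (inj₂ e) → suc%≢ 3≤ℓ (toℕ<n i) e }
  }
  where
  Next : Rel (Fin ℓ) 0ℓ
  Next i j = (suc (toℕ i) % ℓ) {{nonZero 3≤ℓ}} ≡ toℕ j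

C : ∀ ℓ {3≤ℓ : True (3 ≤? ℓ)} → FiniteGraph
C ℓ {3≤ℓ} = ℓ , cycle ℓ (toWitness 3≤ℓ)

C₇ : Graph (Fin 7)
C₇ = proj₂ (C 7)

module _ {V : Set} (G : Graph V) where

  IsClique : Pred V 0ℓ → Set
  IsClique S = ∀ {u v} → u ∈ S → v ∈ S → u ≢ v → Adj G u v

  _UniformTo_ : Pred V 0ℓ → Pred V 0ℓ → Set
  S UniformTo T = (∀ {u v} → u ∈ S → v ∈ T → ¬ Adj G u v)
                ⊎ (∀ {u v} → u ∈ S → v ∈ T → Adj G u v)

  -- A partition of V into k labelled, possibly empty, sets is given by the
  -- function sending each vertex to the index of its set.
  record UniformPartition (k : ℕ) : Set where
    field
      index : V → Fin k

    part : Fin k → Pred V 0ℓ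
    part i v = index v ≡ i

    field
      clique  : ∀ i → IsClique (part i)
      uniform : ∀ i j → j ≢ i → part j UniformTo part i

{-# OPTIONS --safe #-}

-- Sort the vertices outside the 7-cycle according to which vertices of the
-- cycle they see.  Only 22 of these subsets extend C₇ by a vertex without
-- creating a forbidden subgraph through it: everything, and the rotations of
-- {0,1,2,3,4}, {0,1,2} and {0,1,4}.  Two vertices seeing the same subset must be
-- adjacent, and for any two of the 22 subsets at most one of "adjacent" and
-- "nonadjacent" avoids a forbidden subgraph on the nine vertices at hand.  So
-- grouping vertices by the subset they see is a uniform partition.  These are
-- finitely many small cases, settled by running a backtracking search.
module Submission where

open import Defs
open import Data.Bool.Base using (true)
import Data.Bool.Properties as Bool
open import Data.Empty using (⊥; ⊥-elim; ⊥-elim-irr)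
open import Data.Fin.Base using (Fin; zero; suc; toℕ)
open import Data.Fin.Properties using (_≟_; any?; suc-injective; 0≢1+n)
open import Data.Fin.Subset using (Subset; Side; inside; outside; ⊤; _∈_)
open import Data.Fin.Subset.Properties using (_∈?_; anySubset?; drop-there)
open import Data.Irrelevant using ([_])
open import Data.List.Base using (List; _∷_; []; concatMap; iterate; length)
import Data.List.Base as List
open import Data.List.Membership.Propositional using () renaming (_∈_ to _∈ˡ_)
open import Data.List.Membership.Propositional.Properties using (∈-lookup)
import Data.List.Membership.DecPropositional as DecMembership
open import Data.List.Relation.Unary.All as All using (All)
import Data.List.Relation.Unary.Any as Any
open import Data.List.Relation.Unary.Any.Properties using (lookup-index)
open import Data.Nat.Base using (ℕ; zero; suc)
import Data.Nat.Properties as ℕ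
open import Data.Product.Base using (Σ-syntax; ∃-syntax; _×_; _,_; proj₁; proj₂; uncurry)
open import Data.Refinement using (Refinement-syntax; value; value-injective; _,_)
open import Data.Sum.Base using (inj₁; inj₂)
open import Data.Vec.Base using (_∷_; []; _∷ʳ_; here; there; tabulate)
open import Data.Vec.Properties using (≡-dec; lookup∘tabulate; lookup⇒[]=; []=⇒lookup)
open import Function.Base using (_∘_; id)
open import Function.Bundles using (_⇔_; mk⇔; Equivalence)
import Function.Construct.Composition as Compose
open import Level using (0ℓ)
open import Relation.Binary.PropositionalEquality using (_≡_; _≢_; refl; sym; trans; cong; subst; subst₂)
open import Relation.Nullary using (¬_; Dec; yes; no; does)
open import Relation.Nullary.Decidable
  using (map′; _×-dec_; _→-dec_; ¬?; dec-true; decidable-stable)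
open import Relation.Unary using (Pred; Decidable; _∉_)

open Equivalence

private
  variable
    m n : ℕ
    A B U V W : Set

_⇔-dec_ : Dec A → Dec B → Dec (A ⇔ B)
a? ⇔-dec b? = map′ (uncurry mk⇔) (λ e → to e , from e) ((a? →-dec b?) ×-dec (b? →-dec a?))

-- Unlike from-yes, this evaluates only the boolean of the decision, which makes
-- the searches below affordable.
does-true⇒ : ∀ {a} {A : Set a} (a? : Dec A) → does a? ≡ true → A
does-true⇒ (yes a) _ = a

-- Searching for induced subgraphs

-- `P i` is the set of candidates for the image of vertex `i`. Arbitrary candidate sets make the
-- search recursive: what the vertices already placed demand of the others is absorbed into `P`.
Placement : Graph (Fin m) → Graph (Fin n) → (Fin m → Pred (Fin n) 0ℓ) → Set
Placement H G P = Σ[ e ∈ H Induced⊆ G ] (∀ i → P i (vertex e i))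

tail : Graph (Fin (suc m)) → Graph (Fin m)
tail H .Adj i j  = Adj H (suc i) (suc j)
tail H .adj? i j = adj? H (suc i) (suc j)
tail H .symm     = symm H
tail H .irrefl   = irrefl H

module _ (G : Graph (Fin n)) where

  Residual : Graph (Fin (suc m)) → (Fin (suc m) → Pred (Fin n) 0ℓ) →
             Fin n → Fin m → Pred (Fin n) 0ℓ
  Residual H P x i y = P (suc i) y × x ≢ y × (Adj H zero (suc i) ⇔ Adj G x y)

  place-zero : (H : Graph (Fin (suc m))) (P : Fin (suc m) → Pred (Fin n) 0ℓ) →
               ∃[ x ] P zero x × Placement (tail H) G (Residual H P x) → Placement H G P
  place-zero H P (x , Px , e , r) = e⁺ , λ { zero → Px ; (suc i) → proj₁ (r i) }
    where
    e⁺ : H Induced⊆ G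
    e⁺ .vertex zero    = x
    e⁺ .vertex (suc i) = vertex e i
    e⁺ .injective {zero}  {zero}  _  = refl
    e⁺ .injective {zero}  {suc j} eq = ⊥-elim (proj₁ (proj₂ (r j)) eq)
    e⁺ .injective {suc i} {zero}  eq = ⊥-elim (proj₁ (proj₂ (r i)) (sym eq))
    e⁺ .injective {suc i} {suc j} eq = cong suc (injective e eq)
    e⁺ .induced zero    zero    = mk⇔ (⊥-elim ∘ irrefl H) (⊥-elim ∘ irrefl G)
    e⁺ .induced zero    (suc j) = proj₂ (proj₂ (r j))
    e⁺ .induced (suc i) zero    = let xy = proj₂ (proj₂ (r i)) in
      mk⇔ (symm G ∘ to xy ∘ symm H) (symm H ∘ from xy ∘ symm G)
    e⁺ .induced (suc i) (suc j) = induced e i j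

  unplace-zero : (H : Graph (Fin (suc m))) (P : Fin (suc m) → Pred (Fin n) 0ℓ) →
                 Placement H G P → ∃[ x ] P zero x × Placement (tail H) G (Residual H P x)
  unplace-zero H P (e , p) = vertex e zero , p zero , e⁻ , λ i →
    p (suc i) , (0≢1+n ∘ injective e) , induced e zero (suc i)
    where
    e⁻ : tail H Induced⊆ G
    e⁻ .vertex      = vertex e ∘ suc
    e⁻ .injective   = suc-injective ∘ injective e
    e⁻ .induced i j = induced e (suc i) (suc j)

  -- Backtracking over the image of vertex `zero`. The candidate test comes first in the
  -- conjunction, so its failure cuts off the whole branch below `x`.
  placement? : (H : Graph (Fin m)) (P : Fin m → Pred (Fin n) 0ℓ) →
               (∀ i → Decidable (P i)) → Dec (Placement H G P)
  placement? {zero} H P P? = yes (record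
    { vertex = λ () ; injective = λ { {()} } ; induced = λ () } , λ ())
  placement? {suc m} H P P? = map′ (place-zero H P) (unplace-zero H P)
    (any? λ x → P? zero x ×-dec placement? (tail H) (Residual H P x) λ i y →
      P? (suc i) y ×-dec ¬? (x ≟ y) ×-dec (adj? H zero (suc i) ⇔-dec adj? G x y))

  -- Only copies sending vertex 0 to x are excluded.  The forbidden graphs are
  -- vertex-transitive, so these are all copies through x, and fixing the first
  -- vertex makes the search several times shorter.
  _-freeAt_ : List FiniteGraph → Fin n → Set₁
  L -freeAt x = All (λ (_ , H) → ¬ Placement H G (λ i y → toℕ i ≡ 0 → y ≡ x)) L

  freeAt? : ∀ L x → Dec (L -freeAt x)
  freeAt? L x = All.all?
    (λ (_ , H) → ¬? (placement? H _ λ i y → (toℕ i ℕ.≟ 0) →-dec (y ≟ x))) L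

Induced⊆-trans : {F : Graph U} {H : Graph V} {G : Graph W} →
                 F Induced⊆ H → H Induced⊆ G → F Induced⊆ G
Induced⊆-trans d e .vertex      = vertex e ∘ vertex d
Induced⊆-trans d e .injective   = injective d ∘ injective e
Induced⊆-trans d e .induced u v =
  Compose.equivalence (induced d u v) (induced e (vertex d u) (vertex d v))

-- This passes from an arbitrary `G` to decidable conditions on a small graph. Freeness at `x` is
-- only a necessary condition, which suffices because the searches serve to refute it.
free⇒freeAt : ∀ {L} {H : Graph (Fin n)} {G : Graph V} →
              H Induced⊆ G → (L -free) G → ∀ x → _-freeAt_ H L x
free⇒freeAt e free x = All.map (λ F⊈G (d , _) → F⊈G (Induced⊆-trans d e)) free

-- Adding a vertex

-- The new vertex is `zero`, so that testing freeness at `zero` looks for copies through it.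
_◂_ : Subset n → Graph (Fin n) → Graph (Fin (suc n))
(s ◂ H) .Adj zero    zero    = ⊥
(s ◂ H) .Adj zero    (suc j) = j ∈ s
(s ◂ H) .Adj (suc i) zero    = i ∈ s
(s ◂ H) .Adj (suc i) (suc j) = Adj H i j
(s ◂ H) .adj? zero    zero    = no id
(s ◂ H) .adj? zero    (suc j) = j ∈? s
(s ◂ H) .adj? (suc i) zero    = i ∈? s
(s ◂ H) .adj? (suc i) (suc j) = adj? H i j
(s ◂ H) .symm {zero}  {suc j} = id
(s ◂ H) .symm {suc i} {zero}  = id
(s ◂ H) .symm {suc i} {suc j} = symm H
(s ◂ H) .irrefl {suc i} = irrefl H

module _ {H : Graph (Fin n)} {G : Graph V} (e : H Induced⊆ G) where

  Sees : V → Subset n → Set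
  Sees v s = ∀ i → i ∈ s ⇔ Adj G v (vertex e i)

  seen : V → Subset n
  seen v = tabulate (λ i → does (adj? G v (vertex e i)))

  sees-seen : ∀ v → Sees v (seen v)
  sees-seen v i = mk⇔
    (λ i∈s → does-true⇒ vi? (trans (sym (lookup∘tabulate _ i)) ([]=⇒lookup i∈s)))
    (λ vi → lookup⇒[]= i _ (trans (lookup∘tabulate _ i) (dec-true vi? vi)))
    where vi? = adj? G v (vertex e i)

  -- The first hypothesis is irrelevant because a vertex of `G - vertices c` carries it only
  -- irrelevantly; it serves just to refute equations.
  extend : ∀ {v s} → .(v ∉ vertices e) → Sees v s → (s ◂ H) Induced⊆ G
  extend {v} {s} v∉e v∼s = e⁺
    where
    e⁺ : (s ◂ H) Induced⊆ G
    e⁺ .vertex zero    = v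
    e⁺ .vertex (suc i) = vertex e i
    e⁺ .injective {zero}  {zero}  _  = refl
    e⁺ .injective {zero}  {suc j} eq = ⊥-elim-irr (v∉e (j , sym eq))
    e⁺ .injective {suc i} {zero}  eq = ⊥-elim-irr (v∉e (i , eq))
    e⁺ .injective {suc i} {suc j} eq = cong suc (injective e eq)
    e⁺ .induced zero    zero    = mk⇔ ⊥-elim (⊥-elim ∘ irrefl G)
    e⁺ .induced zero    (suc j) = v∼s j
    e⁺ .induced (suc i) zero    = mk⇔ (symm G ∘ to (v∼s i)) (from (v∼s i) ∘ symm G)
    e⁺ .induced (suc i) (suc j) = induced e i j

-- `v` is added first, so `u` ends up at `zero` and `v` at `suc zero`; the leading bit `b` then
-- records whether `u` sees `v`.
extend₂ : ∀ {H : Graph (Fin n)} {G : Graph V} (e : H Induced⊆ G) {u v s t b} →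
          .(u ∉ vertices e) → .(v ∉ vertices e) → u ≢ v → Sees e u s → Sees e v t →
          (zero ∈ (b ∷ s) ⇔ Adj G u v) → ((b ∷ s) ◂ (t ◂ H)) Induced⊆ G
extend₂ e u∉e v∉e u≢v u∼s v∼t uv = extend (extend e v∉e v∼t)
  (λ { (zero , eq) → u≢v (sym eq) ; (suc i , eq) → u∉e (i , eq) })
  (λ { zero    → uv
     ; (suc i) → mk⇔ (to (u∼s i) ∘ drop-there) (there ∘ from (u∼s i)) })

-- Grouping the remaining vertices by what they see

module _ (L : List FiniteGraph) (H : Graph (Fin n)) where

  -- The side tells whether the two new vertices are adjacent.
  Possible : Side → Subset n → Subset n → Set₁
  Possible b s t = _-freeAt_ ((b ∷ s) ◂ (t ◂ H)) L zero

  possible? : ∀ b s t → Dec (Possible b s t)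
  possible? b s t = freeAt? ((b ∷ s) ◂ (t ◂ H)) L zero

module _
  {L : List FiniteGraph} {H : Graph (Fin n)} (types : List (Subset n))
  (types-complete : ∀ s → _-freeAt_ (s ◂ H) L zero → s ∈ˡ types)
  (same-type⇒adjacent : All (λ s → ¬ Possible L H outside s s) types)
  (adjacency-determined :
    All (λ s → All (λ t → ¬ (Possible L H outside s t × Possible L H inside s t)) types) types)
  {G : Graph V} (free : (L -free) G) (c : H Induced⊆ G)
  where

  Outside : Set
  Outside = [ v ∈ V ∣ v ∉ vertices c ]

  type : Outside → Subset n
  type = seen c ∘ value

  type∈types : ∀ v → type v ∈ˡ types
  type∈types (v , [ v∉c ]) =
    types-complete _ (free⇒freeAt (extend c v∉c (sees-seen c v)) free zero)

  adjacent⇒possible : ∀ u v → Adj G (value u) (value v) → Possible L H inside (type u) (type v)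
  adjacent⇒possible u@(_ , [ u∉c ]) v@(_ , [ v∉c ]) uv = free⇒freeAt
    (extend₂ c u∉c v∉c (λ eq → irrefl G (subst (Adj G _) (sym eq) uv))
      (sees-seen c _) (sees-seen c _) (mk⇔ (λ _ → uv) (λ _ → here)))
    free zero

  nonadjacent⇒possible : ∀ u v → u ≢ v → ¬ Adj G (value u) (value v) →
                         Possible L H outside (type u) (type v)
  nonadjacent⇒possible u@(_ , [ u∉c ]) v@(_ , [ v∉c ]) u≢v ¬uv = free⇒freeAt
    (extend₂ c u∉c v∉c (u≢v ∘ value-injective)
      (sees-seen c _) (sees-seen c _) (mk⇔ (λ ()) (⊥-elim ∘ ¬uv)))
    free zero

  typePartition : UniformPartition (G - vertices c) (length types)
  typePartition = record { index = index ; clique = clique ; uniform = uniform }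
    where
    index : Outside → Fin (length types)
    index v = Any.index (type∈types v)

    type≡ : ∀ v {i} → index v ≡ i → type v ≡ List.lookup types i
    type≡ v refl = lookup-index (type∈types v)

    possible-at : ∀ {b i j} u v → index u ≡ i → index v ≡ j →
                  Possible L H b (type u) (type v) →
                  Possible L H b (List.lookup types i) (List.lookup types j)
    possible-at u v u∈i v∈j = subst₂ (Possible L H _) (type≡ u u∈i) (type≡ v v∈j)

    clique : ∀ i → IsClique (G - vertices c) (λ v → index v ≡ i)
    clique i {u} {v} u∈i v∈i u≢v = decidable-stable (adj? G _ _) λ ¬uv →
      All.lookup same-type⇒adjacent (type∈types u)
        (subst (Possible L H outside (type u)) (trans (type≡ v v∈i) (sym (type≡ u u∈i)))
          (nonadjacent⇒possible u v u≢v ¬uv))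

    uniform : ∀ i j → j ≢ i →
              _UniformTo_ (G - vertices c) (λ v → index v ≡ j) (λ v → index v ≡ i)
    -- The alternative has to be chosen for all pairs of vertices at once, so it is decided from the
    -- two types alone.
    uniform i j j≢i = split (possible? L H outside (List.lookup types j) (List.lookup types i))
      where
      split : Dec (Possible L H outside (List.lookup types j) (List.lookup types i)) → _
      split (yes nonadj) = inj₁ λ {u} {v} u∈j v∈i uv →
        All.lookup (All.lookup adjacency-determined (∈-lookup j)) (∈-lookup i)
          (nonadj , possible-at u v u∈j v∈i (adjacent⇒possible u v uv))
      split (no ¬nonadj) = inj₂ λ {u} {v} u∈j v∈i → decidable-stable (adj? G _ _) λ ¬uv →
        ¬nonadj (possible-at u v u∈j v∈i
          (nonadjacent⇒possible u v (λ { refl → j≢i (trans (sym u∈j) v∈i) }) ¬uv))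

-- Neighbourhoods in C₇

forbidden : List FiniteGraph
forbidden = 4K₁ ∷ C 4 ∷ C 6 ∷ []

turn : Subset n → Subset n
turn []      = []
turn (b ∷ s) = s ∷ʳ b

-- Each pattern contributes itself and six further rotations, distinct since 7 is prime, which gives
-- 1 + 3 · 7 = 22 entries.
C₇Types : List (Subset 7)
C₇Types = ⊤ ∷ concatMap (λ s → iterate turn s 7)
  ( (inside ∷ inside ∷ inside ∷ inside  ∷ inside  ∷ outside ∷ outside ∷ [])
  ∷ (inside ∷ inside ∷ inside ∷ outside ∷ outside ∷ outside ∷ outside ∷ [])
  ∷ (inside ∷ inside ∷ outside ∷ outside ∷ inside ∷ outside ∷ outside ∷ [])
  ∷ [])

_∈C₇Types? : Decidable (_∈ˡ C₇Types)
_∈C₇Types? s = DecMembership._∈?_ (≡-dec Bool._≟_) s C₇Types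

C₇Types-complete : ∀ s → _-freeAt_ (s ◂ C₇) forbidden zero → s ∈ˡ C₇Types
C₇Types-complete s free = decidable-stable (s ∈C₇Types?) λ s∉ → none (s , free , s∉)
  where
  -- Quantifying over all 128 subsets gives a closed decision, which `refl` can evaluate.
  none = does-true⇒ (¬? (anySubset? λ s →
    freeAt? (s ◂ C₇) forbidden zero ×-dec ¬? (s ∈C₇Types?))) refl

-- Every type contains two nonadjacent vertices of the cycle; with two nonadjacent vertices seeing
-- both, they form an induced `C 4`.
same-type⇒adjacent : All (λ s → ¬ Possible forbidden C₇ outside s s) C₇Types
same-type⇒adjacent = does-true⇒
  (All.all? (λ s → ¬? (possible? forbidden C₇ outside s s)) C₇Types) refl

-- For all 484 ordered pairs of types, copies through the first new vertex alone already rule out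
-- one of the two sides.
adjacency-determined :
  All (λ s → All (λ t →
    ¬ (Possible forbidden C₇ outside s t × Possible forbidden C₇ inside s t)) C₇Types) C₇Types
adjacency-determined = does-true⇒ (All.all? (λ s → All.all? (λ t →
  ¬? (possible? forbidden C₇ outside s t ×-dec possible? forbidden C₇ inside s t)) C₇Types) C₇Types) refl

theorem2p7 : ∃[ k ] (∀ {n : ℕ} (G : Graph (Fin n)) → ((4K₁ ∷ C 4 ∷ C 6 ∷ []) -free) G → (c : C₇ Induced⊆ G) → UniformPartition (G - vertices c) k)
theorem2p7 = length C₇Types , λ G free c →
  typePartition C₇Types C₇Types-complete same-type⇒adjacent adjacency-determined free c
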